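{- Let $\mathcal P=\langle F,R\rangle$ be a program and $H$ a hypothesis. Let $IF(F,H)=\{A\mid F(A)\neq\mathcal U,\ H(A)\neq\mathcal U,\ F(A)\neq H(A)\}$, $PF_0=\emptyset$, and for $i\ge1$ $$PF_i=\{A\mid A\leftarrow B\in R \text{ and } B\not\equiv H(A)\text{ w.r.t. } F\oplus H_{/(\mathcal{HB}_{\mathcal P}\setminus IF(F,H))\setminus PF_{i-1}}\},$$ and let $PF=\bigcup_i PF_i$ (the limit of this increasing sequence). Then $$s^H_{\mathcal P}=H_{/(\mathcal{HB}_{\mathcal P}\setminus IF(F,H))\setminus PF}.$$
   Context: Let $\langle \mathcal{B},\le_t,\le_k\rangle$ be a complete, infinitely distributive bilattice with negation satisfying the infinitary interlacing conditions; $\wedge,\vee$ are meet/join for $\le_t$, $\otimes,\oplus$ meet/join for $\le_k$, $\mathcal U$ is the bottom of $\le_k$. A closed formula is built from ground literals and elements of $\mathcal B$ using $\wedge,\vee,\otimes,\oplus,\exists,\forall$ (quantifiers over closed terms). A program $\mathcal P=\langle F,R\rangle$ consists of a function $F$ from the Herbrand base $\mathcal{HB}_{\mathcal P}$ to $\mathcal B$ and a finite set $R$ of ground clauses $A\leftarrow B$, each ground atom being the head of at most one clause; $Head(\mathcal P)$ is the set of heads. An interpretation (hypothesis) is a function $\mathcal{HB}_{\mathcal P}\to\mathcal B$, extended to closed formulas homomorphically ($I(\neg A)=\neg I(A)$, $I(X\wedge Y)=I(X)\wedge I(Y)$ etc., $\exists$ as $\bigvee$, $\forall$ as $\bigwedge$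 over closed instances). Operations on interpretations are pointwise. $I,J$ are compatible if $I(A)\neq\mathcal U$ and $J(A)\neq\mathcal U$ imply $I(A)=J(A)$. $I\le J$ means $I(A)\neq\mathcal U\Rightarrow I(A)=J(A)$ for all $A$. $I_{/S}$ is $I$ on $S$ and $\mathcal U$ elsewhere. $B\equiv_I\alpha$ means $J(B)=\alpha$ for all $J$ with $I\le J$. $T_R(I)(A)=\alpha$ if there is a clause $A\leftarrow B$ in $R$ with $B\equiv_I\alpha$, and $\mathcal U$ otherwise. $H'$ is sound w.r.t. $\mathcal P$ if $F,H'$ are compatible and $H'_{/Head(\mathcal P)}\le T_R(F\oplus H')$. The support $s^H_{\mathcal P}$ is the maximal (w.r.t. $\le$) interpretation $H'\le H$ that is sound w.r.t. $\mathcal P$, i.e. $\bigoplus\{H'\mid H'\le H,\ H'\text{ sound}\}$. -}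

module Defs where

open import Level using (Level; suc; Lift)
open import Algebra.Core using (Op₁; Op₂)
open import Axiom.ExcludedMiddle using (ExcludedMiddle)
open import Data.Empty using (⊥)
open import Data.Fin.Base using (Fin)
open import Data.List.Base using (List)
open import Data.List.Membership.Propositional using (_∈_)
open import Data.Nat.Base as ℕ using (ℕ; zero)
open import Data.Product.Base using (Σ; ∃; ∃-syntax; _×_; _,_; proj₁)
open import Data.Vec.Base using (Vec; []; _∷_; lookup)
open import Relation.Binary.Core using (Rel)
open import Relation.Binary.Definitions using (Minimum)
open import Relation.Binary.Lattice.Structures using (IsLattice)
open import Relation.Binary.PropositionalEquality.Core using (_≡_)
open import Relation.Nullary using (¬_; yes; no)
open import Relation.Unary using (Pred; U; _∖_; ⋃)

module _ {ℓ : Level} {A : Set ℓ} where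

  BigOp : Set (suc ℓ)
  BigOp = {I : Set ℓ} → (I → A) → A

  IsBigJoin : Rel A ℓ → BigOp → Set (suc ℓ)
  IsBigJoin _≤_ ⨆ = ∀ {I : Set ℓ} (f : I → A) →
    (∀ i → f i ≤ ⨆ f) × (∀ x → (∀ i → f i ≤ x) → ⨆ f ≤ x)

  IsBigMeet : Rel A ℓ → BigOp → Set (suc ℓ)
  IsBigMeet _≤_ ⨅ = ∀ {I : Set ℓ} (f : I → A) →
    (∀ i → ⨅ f ≤ f i) × (∀ x → (∀ i → x ≤ f i) → x ≤ ⨅ f)

  MonotoneBigOp : Rel A ℓ → BigOp → Set (suc ℓ)
  MonotoneBigOp _≤_ ⨀ = ∀ {I : Set ℓ} (f g : I → A) →
    (∀ i → f i ≤ g i) → ⨀ f ≤ ⨀ g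

  -- The family must be inhabited: a law such as  a ∧ ⨁ᵢ bᵢ ≈ ⨁ᵢ (a ∧ bᵢ)
  -- fails for the empty family already in Belnap's four-valued bilattice
  -- (where  false ∧ ⨁∅ ≈ false).  Laws relating ∧ to ⋁, and so on, within
  -- a single lattice then extend to the empty family automatically.
  Distributes : Rel A ℓ → Op₂ A → BigOp → Set (suc ℓ)
  Distributes _≈_ _∙_ ⨀ = ∀ {I : Set ℓ} → I → ∀ a (b : I → A) →
    (a ∙ ⨀ b) ≈ ⨀ (λ i → a ∙ b i)

-- A complete, infinitely distributive bilattice with negation satisfying
-- the infinitary interlacing conditions.  The finitary distributive and
-- interlacing laws are the instances at two-element families.

record Bilattice (ℓ : Level) : Set (suc ℓ) where
  infix  4 _≈_ _≤t_ _≤k_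
  infixr 7 _∧_ _⊗_
  infixr 6 _∨_ _⊕_
  infix  8 ∼_
  field
    Carrier         : Set ℓ
    _≈_ _≤t_ _≤k_   : Rel Carrier ℓ
    _∧_ _∨_ _⊗_ _⊕_ : Op₂ Carrier
    ⋀ ⋁ ⨂ ⨁         : BigOp {A = Carrier}
    ∼_              : Op₁ Carrier
    𝒰               : Carrier

    isLattice-t : IsLattice _≈_ _≤t_ _∨_ _∧_
    isLattice-k : IsLattice _≈_ _≤k_ _⊕_ _⊗_

    ⋀-meet : IsBigMeet _≤t_ ⋀
    ⋁-join : IsBigJoin _≤t_ ⋁
    ⨂-meet : IsBigMeet _≤k_ ⨂
    ⨁-join : IsBigJoin _≤k_ ⨁

    𝒰-minimum : Minimum _≤k_ 𝒰

    ∼-antitone-t : ∀ {x y} → x ≤t y → ∼ y ≤t ∼ x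
    ∼-monotone-k : ∀ {x y} → x ≤k y → ∼ x ≤k ∼ y
    ∼-involutive : ∀ x → ∼ (∼ x) ≈ x

    ⋀-monotone-k : MonotoneBigOp _≤k_ ⋀
    ⋁-monotone-k : MonotoneBigOp _≤k_ ⋁
    ⨂-monotone-t : MonotoneBigOp _≤t_ ⨂
    ⨁-monotone-t : MonotoneBigOp _≤t_ ⨁

    ∧-distrib-⋁ : Distributes _≈_ _∧_ ⋁
    ∧-distrib-⨂ : Distributes _≈_ _∧_ ⨂
    ∧-distrib-⨁ : Distributes _≈_ _∧_ ⨁
    ∨-distrib-⋀ : Distributes _≈_ _∨_ ⋀
    ∨-distrib-⨂ : Distributes _≈_ _∨_ ⨂
    ∨-distrib-⨁ : Distributes _≈_ _∨_ ⨁
    ⊗-distrib-⋀ : Distributes _≈_ _⊗_ ⋀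
    ⊗-distrib-⋁ : Distributes _≈_ _⊗_ ⋁
    ⊗-distrib-⨁ : Distributes _≈_ _⊗_ ⨁
    ⊕-distrib-⋀ : Distributes _≈_ _⊕_ ⋀
    ⊕-distrib-⋁ : Distributes _≈_ _⊕_ ⋁
    ⊕-distrib-⨂ : Distributes _≈_ _⊕_ ⨂

record Language (ℓ : Level) : Set (suc ℓ) where
  field
    FunSym    : Set ℓ
    funArity  : FunSym → ℕ
    PredSym   : Set ℓ
    predArity : PredSym → ℕ

module Syntax {ℓ : Level} (L : Language ℓ) where
  open Language L

  -- De Bruijn: the index n counts the variables that may occur free.
  data Term (n : ℕ) : Set ℓ where
    var : Fin n → Term n
    app : (f : FunSym) → Vec (Term n) (funArity f) → Term n

  ClosedTerm : Set ℓ
  ClosedTerm = Term 0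

  record Atom (n : ℕ) : Set ℓ where
    constructor atom
    field
      symbol    : PredSym
      arguments : Vec (Term n) (predArity symbol)

  HerbrandBase : Set ℓ
  HerbrandBase = Atom 0

  data Formula (C : Set ℓ) (n : ℕ) : Set ℓ where
    pos neg             : Atom n → Formula C n
    const               : C → Formula C n
    _∧′_ _∨′_ _⊗′_ _⊕′_ : Formula C n → Formula C n → Formula C n
    ∃′ ∀′               : Formula C (ℕ.suc n) → Formula C n

  mutual
    _[_]ᵗ : ∀ {n} → Term n → Vec ClosedTerm n → ClosedTerm
    var x    [ ρ ]ᵗ = lookup ρ x
    app f ts [ ρ ]ᵗ = app f (ts [ ρ ]ᵗˢ)

    _[_]ᵗˢ : ∀ {n m} → Vec (Term n) m → Vec ClosedTerm n → Vec ClosedTerm m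
    []       [ ρ ]ᵗˢ = []
    (t ∷ ts) [ ρ ]ᵗˢ = (t [ ρ ]ᵗ) ∷ (ts [ ρ ]ᵗˢ)

  _[_]ᵃ : ∀ {n} → Atom n → Vec ClosedTerm n → HerbrandBase
  atom p ts [ ρ ]ᵃ = atom p (ts [ ρ ]ᵗˢ)

-- The theory is classical: excluded middle is needed already to define
-- I_{/S} and T_R by cases.

module Semantics {ℓ : Level} (em : ExcludedMiddle ℓ)
                 (𝓑 : Bilattice ℓ) (L : Language ℓ) where
  open Bilattice 𝓑
  open Syntax L public

  ClosedFormula : Set ℓ
  ClosedFormula = Formula Carrier 0

  infix 4 _←_
  record Clause : Set ℓ where
    constructor _←_
    field
      head : HerbrandBase
      body : ClosedFormula

  Interpretation : Set ℓ
  Interpretation = HerbrandBase → Carrier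

  record Program : Set ℓ where
    field
      F      : Interpretation
      R      : List Clause
      unique : ∀ {A B B′} → (A ← B) ∈ R → (A ← B′) ∈ R → B ≡ B′

  Head : List Clause → Pred HerbrandBase ℓ
  Head R A = ∃[ B ] (A ← B) ∈ R

  -- eval I φ ρ is the value under I of the closed instance φ[ρ].
  eval : Interpretation → ∀ {n} → Formula Carrier n → Vec ClosedTerm n → Carrier
  eval I (pos A)   ρ = I (A [ ρ ]ᵃ)
  eval I (neg A)   ρ = ∼ I (A [ ρ ]ᵃ)
  eval I (const c) ρ = c
  eval I (φ ∧′ ψ)  ρ = eval I φ ρ ∧ eval I ψ ρ
  eval I (φ ∨′ ψ)  ρ = eval I φ ρ ∨ eval I ψ ρ
  eval I (φ ⊗′ ψ)  ρ = eval I φ ρ ⊗ eval I ψ ρ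
  eval I (φ ⊕′ ψ)  ρ = eval I φ ρ ⊕ eval I ψ ρ
  eval I (∃′ φ)    ρ = ⋁ (λ (t : ClosedTerm) → eval I φ (t ∷ ρ))
  eval I (∀′ φ)    ρ = ⋀ (λ (t : ClosedTerm) → eval I φ (t ∷ ρ))

  ⟦_⟧ : ClosedFormula → Interpretation → Carrier
  ⟦ B ⟧ I = eval I B []

  infix  4 _≐_ _≼_ _≡[_]_
  infixl 7 _↾_
  infixr 6 _⊕ᴵ_

  _≐_ : Rel Interpretation ℓ
  I ≐ J = ∀ A → I A ≈ J A

  _⊕ᴵ_ : Op₂ Interpretation
  (I ⊕ᴵ J) A = I A ⊕ J A

  Defined : Interpretation → Pred HerbrandBase ℓ
  Defined I A = ¬ (I A ≈ 𝒰)

  Compatible : Rel Interpretation ℓ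
  Compatible I J = ∀ A → Defined I A → Defined J A → I A ≈ J A

  _≼_ : Rel Interpretation ℓ
  I ≼ J = ∀ A → Defined I A → I A ≈ J A

  -- I ↾ S is I_{/S}.
  _↾_ : Interpretation → Pred HerbrandBase ℓ → Interpretation
  (I ↾ S) A with em {S A}
  ... | yes _ = I A
  ... | no  _ = 𝒰

  _≡[_]_ : ClosedFormula → Interpretation → Carrier → Set ℓ
  B ≡[ I ] α = ∀ J → I ≼ J → ⟦ B ⟧ J ≈ α

  -- The α picked below is unique up to ≈ : a head has only one body B,
  -- and B ≡[ I ] α forces α ≈ ⟦ B ⟧ I.
  T : List Clause → Interpretation → Interpretation
  T R I A with em {∃[ α ] ∃[ B ] (A ← B) ∈ R × B ≡[ I ] α}
  ... | yes (α , _) = α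
  ... | no  _       = 𝒰

  module _ (P : Program) where
    open Program P

    Sound : Pred Interpretation ℓ
    Sound H′ = Compatible F H′ × H′ ↾ Head R ≼ T R (F ⊕ᴵ H′)

    -- The pointwise ⨁ of all sound H′ ≼ H; it is itself such an H′, hence the
    -- ≼-greatest one.
    support : Interpretation → Interpretation
    support H A = ⨁ {I = Σ Interpretation (λ H′ → H′ ≼ H × Sound H′)}
                    (λ (H′ , _) → H′ A)

    IF : Interpretation → Pred HerbrandBase ℓ
    IF H A = Defined F A × Defined H A × ¬ (F A ≈ H A)

    PFᵢ : Interpretation → ℕ → Pred HerbrandBase ℓ
    PFᵢ H zero      A = Lift ℓ ⊥
    PFᵢ H (ℕ.suc i) A = ∃[ B ] (A ← B) ∈ R
      × ¬ (B ≡[ F ⊕ᴵ H ↾ ((U ∖ IF H) ∖ PFᵢ H i) ] H A)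

    PF : Interpretation → Pred HerbrandBase ℓ
    PF H = ⋃ ℕ (PFᵢ H)

{-# OPTIONS --safe #-}
-- Put Kᵢ = H ↾ ((U ∖ IF) ∖ PFᵢ).  For hypotheses compatible with F, the map
-- X ↦ F ⊕ X is ≼-monotone, so the sets PFᵢ increase, and each atom in PF is
-- the head of one of the finitely many clauses; hence PF = PFₙ for some n,
-- which makes Kₙ a sound hypothesis.  Conversely, a sound H′ ≼ H satisfies
-- H′ ≼ Kᵢ for each i by induction: on a head A where H′ is defined, the body
-- is forced to the value H A already by F ⊕ H′, and so by F ⊕ Kᵢ.
module Submission where

open import Axiom.ExcludedMiddle using (ExcludedMiddle)
open import Relation.Unary using (U; _∖_)
open import Defs

open import Data.Empty using (⊥-elim)
open import Data.List.Base using (List; []; _∷_)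
open import Data.List.Membership.Propositional using (_∈_)
open import Data.List.Relation.Unary.Any using (here; there)
open import Data.Nat.Base using (ℕ; zero; suc; _⊔_; _≤′_; ≤′-refl; ≤′-step)
open import Data.Nat.Properties using (m≤m⊔n; m≤n⊔m; ≤⇒≤′)
open import Data.Product.Base using (∃-syntax; _×_; _,_; proj₁; proj₂)
open import Function.Base using (_∘_)
open import Relation.Binary.Lattice.Structures using (IsLattice)
open import Relation.Binary.PropositionalEquality.Core as ≡ using (_≡_)
open import Relation.Nullary using (¬_; yes; no)
open import Relation.Nullary.Decidable using (decidable-stable)
open import Relation.Unary using (Pred; _⊆_; ⋃)

module _ {a ℓ} {A : Set a} {P : ℕ → Pred A ℓ}
         (ascending : ∀ i → P i ⊆ P (suc i)) where

  ascending-≤′ : ∀ {i j} → i ≤′ j → P i ⊆ P j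
  ascending-≤′ ≤′-refl           p = p
  ascending-≤′ (≤′-step {j} i≤j) p = ascending j (ascending-≤′ i≤j p)

  -- Each listed element that ever enters the chain does so at some stage. The list is finite, so
  -- the maximum of these stages serves all of them, the chain being ascending.
  ⋃-attained-on-list : ExcludedMiddle ℓ → (xs : List A) →
    ∃[ n ] (∀ {x} → x ∈ xs → ⋃ ℕ P x → P n x)
  ⋃-attained-on-list em []       = zero , λ ()
  ⋃-attained-on-list em (x ∷ xs)
    with ⋃-attained-on-list em xs | em {⋃ ℕ P x}
  ... | n , attained | no ¬p       = n , λ
    { (here ≡.refl) p → ⊥-elim (¬p p)
    ; (there x∈xs)  p → attained x∈xs p }
  ... | n , attained | yes (m , p) = m ⊔ n , λ
    { (here ≡.refl) _ → ascending-≤′ (≤⇒≤′ (m≤m⊔n m n)) p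
    ; (there x∈xs)  q → ascending-≤′ (≤⇒≤′ (m≤n⊔m m n)) (attained x∈xs q) }

module _ {ℓ} (em : ExcludedMiddle ℓ) (𝓑 : Bilattice ℓ) (L : Language ℓ) where
  open Bilattice 𝓑
  open Semantics em 𝓑 L
  open IsLattice isLattice-k
    using (antisym; reflexive; x≤x∨y; y≤x∨y; ∨-least; module Eq)
    renaming (refl to ≤k-refl; trans to ≤k-trans)

  ≥⇒⊕≈ˡ : ∀ {x y} → y ≤k x → x ⊕ y ≈ x
  ≥⇒⊕≈ˡ y≤x = antisym (∨-least ≤k-refl y≤x) (x≤x∨y _ _)

  ⊕-congˡ : ∀ {x y z} → y ≈ z → x ⊕ y ≈ x ⊕ z
  ⊕-congˡ y≈z = antisym
    (∨-least (x≤x∨y _ _) (≤k-trans (reflexive y≈z) (y≤x∨y _ _)))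
    (∨-least (x≤x∨y _ _) (≤k-trans (reflexive (Eq.sym y≈z)) (y≤x∨y _ _)))

  ↾-∈ : ∀ I S {A} → S A → (I ↾ S) A ≡ I A
  ↾-∈ I S {A} A∈S with em {S A}
  ... | yes _  = ≡.refl
  ... | no A∉S = ⊥-elim (A∉S A∈S)

  ↾-∉ : ∀ I S {A} → ¬ S A → (I ↾ S) A ≡ 𝒰
  ↾-∉ I S {A} A∉S with em {S A}
  ... | yes A∈S = ⊥-elim (A∉S A∈S)
  ... | no _    = ≡.refl

  ↾-defined⇒∈ : ∀ I S {A} → Defined (I ↾ S) A → S A
  ↾-defined⇒∈ I S def =
    decidable-stable em λ A∉S → def (Eq.reflexive (↾-∉ I S A∉S))

  ↾-≼ : ∀ I S → I ↾ S ≼ I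
  ↾-≼ I S A def = Eq.reflexive (↾-∈ I S (↾-defined⇒∈ I S def))

  defined-cong : ∀ {I J A} → I A ≈ J A → Defined I A → Defined J A
  defined-cong I≈J def J≈𝒰 = def (Eq.trans I≈J J≈𝒰)

  ≼-↾ : ∀ {I J} S → I ≼ J → (∀ {A} → Defined I A → S A) → I ≼ J ↾ S
  ≼-↾ S I≼J def⇒∈ A def =
    Eq.trans (I≼J A def) (Eq.reflexive (≡.sym (↾-∈ _ S (def⇒∈ def))))

  ↾-mono : ∀ I {S S′} → S ⊆ S′ → I ↾ S ≼ I ↾ S′
  ↾-mono I {S} {S′} S⊆S′ =
    ≼-↾ S′ (↾-≼ I S) λ def → S⊆S′ (↾-defined⇒∈ I S def)

  ≼-refl : ∀ {I} → I ≼ I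
  ≼-refl A _ = Eq.refl

  ≼-trans : ∀ {I J K} → I ≼ J → J ≼ K → I ≼ K
  ≼-trans {I} {J} I≼J J≼K A def =
    Eq.trans (I≼J A def) (J≼K A (defined-cong {I} {J} (I≼J A def) def))

  -- Only atoms where `J` is `𝒰` and `K` is not could cause trouble: there `K` might raise a value
  -- already given by `I`. Compatibility makes the two values equal, so `K` is absorbed.
  ⊕-monoʳ-≼ : ∀ {I J K} → Compatible I K → J ≼ K → I ⊕ᴵ J ≼ I ⊕ᴵ K
  ⊕-monoʳ-≼ {I} {J} {K} compatible J≼K A def with em {J A ≈ 𝒰}
  ... | no  J≉𝒰 = ⊕-congˡ (J≼K A J≉𝒰)
  ... | yes J≈𝒰 = Eq.trans I⊕J≈I (Eq.sym (≥⇒⊕≈ˡ K≤I))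
    where
    I⊕J≈I : I A ⊕ J A ≈ I A
    I⊕J≈I = ≥⇒⊕≈ˡ (≤k-trans (reflexive J≈𝒰) (𝒰-minimum _))

    K≤I : K A ≤k I A
    K≤I with em {K A ≈ 𝒰}
    ... | yes K≈𝒰 = ≤k-trans (reflexive K≈𝒰) (𝒰-minimum _)
    ... | no  K≉𝒰 = reflexive
      (Eq.sym (compatible A (defined-cong {I ⊕ᴵ J} {I} I⊕J≈I def) K≉𝒰))

  ≡[]-mono : ∀ {B I J α} → I ≼ J → B ≡[ I ] α → B ≡[ J ] α
  ≡[]-mono I≼J B≡α K J≼K = B≡α K (≼-trans I≼J J≼K)

  module _ (P : Program) where
    open Program P

    T-value : ∀ {A B I α} → (A ← B) ∈ R → B ≡[ I ] α → T R I A ≈ α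
    T-value {A} {B} {I} A←B B≡α
      with em {∃[ α ] ∃[ B ] (A ← B) ∈ R × B ≡[ I ] α}
    ... | no  ¬forced                = ⊥-elim (¬forced (_ , B , A←B , B≡α))
    ... | yes (β , B′ , A←B′ , B′≡β) with unique A←B A←B′
    ...   | ≡.refl = Eq.trans (Eq.sym (B′≡β I ≼-refl)) (B≡α I ≼-refl)

    -- A value other than `𝒰` is not the default of `T`, so some clause with head `A` forced it; by
    -- `unique` its body is `B`.
    T-defined⇒forced : ∀ {A B I α} → (A ← B) ∈ R → Defined (T R I) A →
                       T R I A ≈ α → B ≡[ I ] α
    T-defined⇒forced {A} {B} {I} A←B def T≈α
      with em {∃[ α ] ∃[ B ] (A ← B) ∈ R × B ≡[ I ] α}
    ... | no  _                      = ⊥-elim (def Eq.refl)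
    ... | yes (β , B′ , A←B′ , B′≡β) with unique A←B A←B′
    ...   | ≡.refl = λ J I≼J → Eq.trans (B′≡β J I≼J) T≈α

    sound⇒forced : ∀ {A B H′} → Sound P H′ → Defined H′ A → (A ← B) ∈ R →
                   B ≡[ F ⊕ᴵ H′ ] H′ A
    sound⇒forced {A} {B} {H′} (_ , founded) def A←B = T-defined⇒forced A←B
      (defined-cong {H′} {T R (F ⊕ᴵ H′)} H′≈T def) (Eq.sym H′≈T)
      where
      onHead : (H′ ↾ Head R) A ≡ H′ A
      onHead = ↾-∈ H′ (Head R) (B , A←B)

      H′≈T : H′ A ≈ T R (F ⊕ᴵ H′) A
      H′≈T = Eq.trans (Eq.reflexive (≡.sym onHead))
        (founded A (defined-cong {H′} {H′ ↾ Head R}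
          (Eq.reflexive (≡.sym onHead)) def))

    module _ (H : Interpretation) where

      -- The removed set is a parameter so that the same lemmas serve the stages `PFᵢ` and the limit
      -- `PF`.
      Retained : Pred HerbrandBase ℓ → Pred HerbrandBase ℓ
      Retained X = (U ∖ IF P H) ∖ X

      Retained-antitone : ∀ {X Y} → X ⊆ Y → Retained Y ⊆ Retained X
      Retained-antitone X⊆Y (A∉IF , A∉Y) = A∉IF , A∉Y ∘ X⊆Y

      -- An atom on which both sides are defined and differ lies in `IF`, which has been removed.
      retained-compatible : ∀ X → Compatible F (H ↾ Retained X)
      retained-compatible X A F-def H↾-def = decidable-stable em λ F≉H↾ →
        proj₂ (proj₁ (↾-defined⇒∈ H (Retained X) H↾-def))
          (F-def , defined-cong {H ↾ Retained X} {H} H↾≈H H↾-def ,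
           λ F≈H → F≉H↾ (Eq.trans F≈H (Eq.sym H↾≈H)))
        where
        H↾≈H : (H ↾ Retained X) A ≈ H A
        H↾≈H = ↾-≼ H (Retained X) A H↾-def

      retained-forced-mono : ∀ {B X Y α} → X ⊆ Y →
        B ≡[ F ⊕ᴵ H ↾ Retained Y ] α → B ≡[ F ⊕ᴵ H ↾ Retained X ] α
      retained-forced-mono {B} {X} {Y} X⊆Y = ≡[]-mono {B}
        (⊕-monoʳ-≼ (retained-compatible X)
          (↾-mono H λ {A} → Retained-antitone {X} {Y} X⊆Y {A}))

      PFᵢ-ascending : ∀ i → PFᵢ P H i ⊆ PFᵢ P H (suc i)
      -- Stage zero is empty. Later, removing more atoms leaves a smaller interpretation, under
      -- which no further body becomes forced.
      PFᵢ-ascending (suc i) (B , A←B , unforced) =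
        B , A←B , unforced ∘ retained-forced-mono {B} λ {A} → PFᵢ-ascending i {A}

      PF-stabilises : ∃[ n ] PF P H ⊆ PFᵢ P H n
      PF-stabilises
        -- The finite list holds clauses, not atoms, so the stages are pulled back along
        -- `Clause.head`.
        with ⋃-attained-on-list {P = λ i → PFᵢ P H i ∘ Clause.head}
               (λ i {c} → PFᵢ-ascending i {Clause.head c}) em R
      ... | n , attained = n , λ
        { A∈PF@(suc i , B , A←B , _) → attained A←B A∈PF }

      -- The limit interpretation lies below every stage, so forcing at a stage does not by itself
      -- descend to it. Stabilisation closes this gap.
      retained-forced : ∀ {A B} → ¬ PF P H A → (A ← B) ∈ R →
                        B ≡[ F ⊕ᴵ H ↾ Retained (PF P H) ] H A
      retained-forced {A} {B} A∉PF A←B with PF-stabilises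
      ... | n , PF⊆PFₙ = retained-forced-mono {B} PF⊆PFₙ
        -- Stage `suc n` tests bodies against what stage `n` retains, so avoiding it means being
        -- forced there.
        (decidable-stable em λ unforced → A∉PF (suc n , B , A←B , unforced))

      retained-sound : Sound P (H ↾ Retained (PF P H))
      retained-sound = retained-compatible (PF P H) , λ A def →
        let B , A←B = ↾-defined⇒∈ G (Head R) def
            G↾≈G    = ↾-≼ G (Head R) A def
            G-def   = defined-cong {G ↾ Head R} {G} G↾≈G def
            A∉PF    = proj₂ (↾-defined⇒∈ H (Retained (PF P H)) G-def)
        in Eq.trans G↾≈G (Eq.trans (↾-≼ H (Retained (PF P H)) A G-def)
             (Eq.sym (T-value A←B (retained-forced A∉PF A←B))))
        where
        G : Interpretation
        G = H ↾ Retained (PF P H)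

      module _ {H′ : Interpretation} (H′≼H : H′ ≼ H) (sound : Sound P H′) where

        sound-defined⇒∉IF : ∀ {A} → Defined H′ A → ¬ IF P H A
        sound-defined⇒∉IF {A} def (F-def , _ , F≉H) =
          F≉H (Eq.trans (proj₁ sound A F-def def) (H′≼H A def))

        sound-defined⇒∉PFᵢ : ∀ i {A} → Defined H′ A → ¬ PFᵢ P H i A
        sound-defined⇒∉PFᵢ (suc i) {A} def (B , A←B , unforced) =
          -- Soundness forces the body to `H′ A`, whereas `PFᵢ` tests for `H A`; the two agree
          -- because `H′ ≼ H` and `H′` is defined at `A`.
          unforced λ J Kᵢ≼J → Eq.trans
            (≡[]-mono {B} (⊕-monoʳ-≼ (retained-compatible (PFᵢ P H i)) H′≼Kᵢ)
              (sound⇒forced sound def A←B) J Kᵢ≼J)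
            (H′≼H A def)
          where
          H′≼Kᵢ : H′ ≼ H ↾ Retained (PFᵢ P H i)
          H′≼Kᵢ = ≼-↾ (Retained (PFᵢ P H i)) H′≼H λ def →
            (_ , sound-defined⇒∉IF def) , sound-defined⇒∉PFᵢ i def

        sound⇒≼-retained : H′ ≼ H ↾ Retained (PF P H)
        sound⇒≼-retained = ≼-↾ (Retained (PF P H)) H′≼H λ def →
          (_ , sound-defined⇒∉IF def) , λ (i , A∈PFᵢ) →
            sound-defined⇒∉PFᵢ i def A∈PFᵢ

    -- The join is taken in `≤k`, not in `≼`. A member of the family is `𝒰` at an atom or agrees
    -- there with `G`, so `G` is an upper bound, and it belongs to the family itself.
    support-greatest : ∀ {H G} → G ≼ H → Sound P G →
      (∀ {H′} → H′ ≼ H → Sound P H′ → H′ ≼ G) → support P H ≐ G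
    support-greatest {H} {G} G≼H sound greatest A = antisym
      (proj₂ (⨁-join _) (G A) below)
      (proj₁ (⨁-join _) (G , G≼H , sound))
      where
      below : ∀ ((H′ , _) : ∃[ H′ ] (H′ ≼ H × Sound P H′)) → H′ A ≤k G A
      below (H′ , H′≼H , sound′) with em {H′ A ≈ 𝒰}
      ... | yes H′≈𝒰 = ≤k-trans (reflexive H′≈𝒰) (𝒰-minimum _)
      ... | no  def  = reflexive (greatest H′≼H sound′ A def)

mainTheorem5 : ∀ {ℓ} (em : ExcludedMiddle ℓ) (𝓑 : Bilattice ℓ) (L : Language ℓ) →
    let open Semantics em 𝓑 L in
    (P : Program) (H : Interpretation) →
    support P H ≐ H ↾ ((U ∖ IF P H) ∖ PF P H)
mainTheorem5 em 𝓑 L P H = support-greatest em 𝓑 L P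
  (↾-≼ em 𝓑 L H _) (retained-sound em 𝓑 L P H) (sound⇒≼-retained em 𝓑 L P H)
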